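{- Let $\mathbb H=(A,\prec,\mathcal C)$ be an sp-algebra with $\mathcal C\subseteq\mathcal C_\prec$, such that $A$ is a Heyting algebra and $\mathbb H$ is $\mathrm{(X)}$-updirected for every $\mathrm{(X)}\in\{\mathrm{(SI)},\mathrm{(WO)},\mathrm{(AND)},\mathrm{(OR)}\}$. Let $S=S(\prec,\mathcal C)$ be the relation $S^{\mathrm{(SI)},\mathrm{(WO)},\mathrm{(AND)},\mathrm{(OR)}}(\prec,\mathcal C)$ and, in the canonical extension $A^\delta$, let $\blacksquare_sb=\bigvee\{a\in A\mid a\,S\,b\}$ and $\blacksquare c=\bigvee\{a\in A\mid a\prec c\}$. Then the following are equivalent: (a) (cross-coherence) for all $a,b,c\in A$, if $a\,S\,b$, $a\prec c$ and $b\wedge c\le\bot$, then $a\le\bot$; (b) $\blacksquare_s(c\to\bot)\wedge\blacksquare c\le\bot$ in $A^\delta$ for all $c\in A$.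
   Context: Canonical extension. For a poset $A$, $A^\delta$ is a complete lattice containing $A$ as a subposet. $k\in A^\delta$ is closed if $k=\bigwedge F$ for some nonempty down-directed $F\subseteq A$; $o$ is open if $o=\bigvee I$ for some nonempty up-directed $I\subseteq A$. Denseness: every element of $A^\delta$ is a join of closed elements and a meet of open elements. Compactness: if $F\subseteq A$ is nonempty down-directed, $I\subseteq A$ nonempty up-directed and $\bigwedge F\le\bigvee I$, then $a\le b$ for some $a\in F$, $b\in I$. $A^\delta$ exists and is unique up to isomorphism fixing $A$; if $A$ is a distributive lattice then $A^\delta$ is completely distributive. Conditions on a binary relation $R$ on $A$: (SI) $a\le b\ \&\ b\,R\,x\Rightarrow a\,R\,x$; (WO) $b\,R\,x\ \&\ x\le y\Rightarrow b\,R\,y$; (AND) $a\,R\,x\ \&\ a\,R\,y\Rightarrow a\,R\,(x\wedge y)$; (OR) $a\,R\,x\ \&\ b\,R\,x\Rightarrow(a\vee b)\,R\,x$. An sp-algebra is $(A,\prec,\mathcal C)$, with $A$ a bounded lattice, such that $\prec$ satisfies $\bot\prec\bot$, $\top\prec\top$, (SI), (WO), (AND), (OR), and $\overline{\mathcal C}=(A\times A)\setminus\mathcal C$ satisfies $\bot\,\overline{\mathcal C}\,\top$; $\top\,\overline{\mathcal C}\,\bot$; $b\,\overline{\mathcal C}\,c\ \&\ a\le b\Rightarrow a\,\overline{\mathcal C}\,c$; $a\,\overline{\mathcal C}\,c\ \&\ b\le c\Rightarrow a\,\overline{\mathcal C}\,b$; $a\,\overline{\mathcal C}\,b\ \&\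 a\,\overline{\mathcal C}\,c\Rightarrow a\,\overline{\mathcal C}\,(b\vee c)$; $a\,\overline{\mathcal C}\,c\ \&\ b\,\overline{\mathcal C}\,c\Rightarrow(a\vee b)\,\overline{\mathcal C}\,c$. $A$ is assumed to belong to the class $\mathsf{Alg}(\mathcal L)$ of a fixed (fully) selfextensional logic $\mathcal L=(\mathrm{Fm},\vdash)$. An $\mathcal L$-filter of $A$ is a subset $F\subseteq A$ such that whenever $\Gamma\vdash\varphi$ and $h:\mathrm{Fm}\to A$ is a homomorphism with $h[\Gamma]\subseteq F$, then $h(\varphi)\in F$; $A\in\mathsf{Alg}(\mathcal L)$ means that distinct elements are separated by $\mathcal L$-filters, and $a\le b$ iff every $\mathcal L$-filter containing $a$ contains $b$. $F(b,c)$ is the $\mathcal L$-filter generated by $\{b,c\}$, and $\mathcal C_\prec:=\{(a,b)\mid\forall c\,(a\prec c\Rightarrow F(b,c)\ne A)\}$. For (R) a condition or list of conditions among (SI), (WO), (AND), (OR), $\prec^{\mathrm{(R)}}$ (resp. $\prec^{\mathrm{(R)}}_{(a,b)}$) is the smallest superset of $\prec$ (resp. of $\prec\cup\{(a,b)\}$) satisfying (R), and $S^{\mathrm{(R)}}(\prec,\mathcal C):=\bigcup\{\prec^{\mathrm{(R)}}_{(a,b)}\mid(a,b)\in\mathcal C\}$ if $\mathcal C\ne\varnothing$, and $\prec^{\mathrm{(R)}}$ otherwise. $\mathbb H$ is (R)-updirected if for all $a\,\mathcal C\,b$ and $c\,\mathcal C\,d$ there are $e\,\mathcal C\,f$ with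 $\prec^{\mathrm{(R)}}_{(a,b)}\cup\prec^{\mathrm{(R)}}_{(c,d)}\ \subseteq\ \prec^{\mathrm{(R)}}_{(e,f)}$. -}

module Defs where

open import Data.Fin.Base using (Fin)
open import Data.List.Base using (List; []; _∷_)
open import Data.List.Membership.Propositional using () renaming (_∈_ to _∈ˡ_)
open import Data.Nat.Base using (ℕ)
open import Data.Product.Base using (Σ; ∃; ∃₂; _×_; _,_; proj₁)
open import Data.Sum.Base using (_⊎_; inj₁; inj₂)
open import Data.Vec.Base using (Vec; map)
open import Data.Vec.Relation.Binary.Pointwise.Inductive
  using (Pointwise; Pointwise-≡⇒≡)
open import Function.Base using (_∘_)
open import Function.Bundles using (_⇔_)
open import Level using (Level; _⊔_; suc)
open import Relation.Binary.Bundles using (Setoid; Poset)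
open import Relation.Binary.Construct.Union using (_∪_)
open import Relation.Binary.Core using (Rel; _⇒_)
open import Relation.Binary.Definitions using (_Respects_; _Respects₂_)
open import Relation.Binary.Lattice.Bundles using (BoundedLattice)
open import Relation.Binary.Morphism.Structures using (IsOrderMonomorphism)
open import Relation.Binary.PropositionalEquality using (_≡_; cong; setoid)
open import Relation.Nullary.Negation using (¬_)
open import Relation.Unary using (Pred; _∈_; _⊆_; Satisfiable)

------------------------------------------------------------------------
-- Algebras and logics

record Signature (l : Level) : Set (suc l) where
  field
    Op    : Set l
    arity : Op → ℕ
    Var   : Set l

  data Fm : Set l where
    var : Var → Fm
    op  : (f : Op) → Vec Fm (arity f) → Fm

record AlgebraOn {l c e : Level} (𝓢 : Signature l) (X : Setoid c e)
                 : Set (l ⊔ c ⊔ e) where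
  open Signature 𝓢
  open Setoid X
  field
    ⟦_⟧     : (f : Op) → Vec Carrier (arity f) → Carrier
    ⟦⟧-cong : ∀ f {xs ys} → Pointwise _≈_ xs ys → ⟦ f ⟧ xs ≈ ⟦ f ⟧ ys

module _ {l : Level} (𝓢 : Signature l) where
  open Signature 𝓢

  formulaAlgebra : AlgebraOn 𝓢 (setoid Fm)
  formulaAlgebra = record
    { ⟦_⟧     = op
    ; ⟦⟧-cong = λ f xs≈ys → cong (op f) (Pointwise-≡⇒≡ xs≈ys)
    }

  IsHom : {c e : Level} (X : Setoid c e) → AlgebraOn 𝓢 X →
          (Fm → Setoid.Carrier X) → Set (l ⊔ e)
  IsHom X 𝐀 h = ∀ f φs → h (op f φs) ≈ ⟦ f ⟧ (map h φs)
    where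
    open Setoid X using (_≈_)
    open AlgebraOn 𝐀 using (⟦_⟧)

record SelfextensionalLogic (l : Level) : Set (suc l) where
  field
    signature : Signature l
  open Signature signature public
  infix 3 _⊢_ _⊣⊢_
  field
    _⊢_ : Pred Fm l → Fm → Set l
    reflexive  : ∀ {Γ φ} → φ ∈ Γ → Γ ⊢ φ
    cut        : ∀ {Γ Δ φ} → (∀ {ψ} → ψ ∈ Δ → Γ ⊢ ψ) → Δ ⊢ φ → Γ ⊢ φ
    structural : ∀ {Γ φ} (σ : Fm → Fm) →
                 IsHom signature (setoid Fm) (formulaAlgebra signature) σ →
                 Γ ⊢ φ → (λ ψ → ∃ λ γ → γ ∈ Γ × ψ ≡ σ γ) ⊢ σ φ

  _⊣⊢_ : Rel Fm l
  φ ⊣⊢ ψ = ((λ χ → χ ≡ φ) ⊢ ψ) × ((λ χ → χ ≡ ψ) ⊢ φ)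

  field
    selfextensional : ∀ f {φs ψs} → Pointwise _⊣⊢_ φs ψs → op f φs ⊣⊢ op f ψs

module Filters {l ℓ : Level} (𝓛 : SelfextensionalLogic l) (P : Poset ℓ ℓ ℓ)
               (𝐀 : AlgebraOn (SelfextensionalLogic.signature 𝓛)
                              (Poset.Eq.setoid P)) where
  open SelfextensionalLogic 𝓛 using (signature; Fm; _⊢_)
  open Poset P using (Carrier; _≈_; _≤_; module Eq)

  record IsFilter (F : Pred Carrier ℓ) : Set (suc l ⊔ ℓ) where
    field
      respects : F Respects _≈_
      closed   : ∀ {Γ φ} → Γ ⊢ φ →
                 (h : Fm → Carrier) → IsHom signature Eq.setoid 𝐀 h →
                 (∀ {γ} → γ ∈ Γ → h γ ∈ F) → h φ ∈ F

  -- The separation property is stated contrapositively.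
  record InAlg : Set (suc l ⊔ suc ℓ) where
    field
      separated : ∀ {a b} → (∀ F → IsFilter F → a ∈ F ⇔ b ∈ F) → a ≈ b
      ≤-filters : ∀ {a b} → a ≤ b ⇔ (∀ F → IsFilter F → a ∈ F → b ∈ F)

  Generated : Pred Carrier ℓ → Pred Carrier (suc l ⊔ suc ℓ)
  Generated X x = ∀ F → IsFilter F → X ⊆ F → x ∈ F

  F⟨_,_⟩ : Carrier → Carrier → Pred Carrier (suc l ⊔ suc ℓ)
  F⟨ b , c ⟩ = Generated (λ x → x ≈ b ⊎ x ≈ c)

  𝒞[_] : Rel Carrier ℓ → Rel Carrier (suc l ⊔ suc ℓ)
  𝒞[ _≺_ ] a b = ∀ c → a ≺ c → ¬ (∀ x → x ∈ F⟨ b , c ⟩)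

------------------------------------------------------------------------
-- Relations on a bounded lattice

data Condition : Set where
  SI WO AND OR : Condition

module Relations {ℓ : Level} (A : BoundedLattice ℓ ℓ ℓ) where
  open BoundedLattice A using (Carrier; _≈_; _≤_; _∧_; _∨_; ⊤; ⊥)

  _Satisfies_ : {q : Level} → Rel Carrier q → Condition → Set (ℓ ⊔ q)
  R Satisfies SI  = ∀ {a b x} → a ≤ b → R b x → R a x
  R Satisfies WO  = ∀ {b x y} → R b x → x ≤ y → R b y
  R Satisfies AND = ∀ {a x y} → R a x → R a y → R a (x ∧ y)
  R Satisfies OR  = ∀ {a b x} → R a x → R b x → R (a ∨ b) x

  -- The smallest relation on the setoid A that contains _≺_ and satisfies the
  -- conditions in Rs, presented inductively.  Since relations on A respect _≈_,
  -- this is part of the closure; see closure-satisfies and closure-least.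
  data Closure (Rs : List Condition) (_≺_ : Rel Carrier ℓ) : Rel Carrier ℓ where
    base : ∀ {a x} → a ≺ x → Closure Rs _≺_ a x
    resp : ∀ {a b x y} → a ≈ b → x ≈ y → Closure Rs _≺_ a x → Closure Rs _≺_ b y
    si   : SI ∈ˡ Rs → ∀ {a b x} → a ≤ b → Closure Rs _≺_ b x → Closure Rs _≺_ a x
    wo   : WO ∈ˡ Rs → ∀ {b x y} → Closure Rs _≺_ b x → x ≤ y → Closure Rs _≺_ b y
    and  : AND ∈ˡ Rs → ∀ {a x y} → Closure Rs _≺_ a x → Closure Rs _≺_ a y →
           Closure Rs _≺_ a (x ∧ y)
    or   : OR ∈ˡ Rs → ∀ {a b x} → Closure Rs _≺_ a x → Closure Rs _≺_ b x →
           Closure Rs _≺_ (a ∨ b) x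

  closure-satisfies : ∀ {Rs _≺_} X → X ∈ˡ Rs → Closure Rs _≺_ Satisfies X
  closure-satisfies SI  X∈Rs = si X∈Rs
  closure-satisfies WO  X∈Rs = wo X∈Rs
  closure-satisfies AND X∈Rs = and X∈Rs
  closure-satisfies OR  X∈Rs = or X∈Rs

  closure-least : ∀ {Rs _≺_} {q : Level} (Q : Rel Carrier q) → Q Respects₂ _≈_ →
                  (∀ X → X ∈ˡ Rs → Q Satisfies X) → _≺_ ⇒ Q → Closure Rs _≺_ ⇒ Q
  closure-least {Rs} {_≺_} Q (respʳ , respˡ) sat ≺⇒Q = go
    where
    go : Closure Rs _≺_ ⇒ Q
    go (base p)         = ≺⇒Q p
    go (resp a≈b x≈y p) = respˡ a≈b (respʳ x≈y (go p))
    go (si X∈Rs a≤b p)  = sat SI X∈Rs a≤b (go p)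
    go (wo X∈Rs p x≤y)  = sat WO X∈Rs (go p) x≤y
    go (and X∈Rs p q)   = sat AND X∈Rs (go p) (go q)
    go (or X∈Rs p q)    = sat OR X∈Rs (go p) (go q)

  -- Closure⁺ Rs _≺_ a b is the closure of _≺_ ∪ {(a , b)}.
  Closure⁺ : List Condition → Rel Carrier ℓ → Carrier → Carrier → Rel Carrier ℓ
  Closure⁺ Rs _≺_ a b = Closure Rs (_≺_ ∪ (λ x y → x ≈ a × y ≈ b))

  S[_] : List Condition → Rel Carrier ℓ → Rel Carrier ℓ → Rel Carrier ℓ
  S[ Rs ] _≺_ 𝒞 x y =
    (∃₂ λ a b → 𝒞 a b × Closure⁺ Rs _≺_ a b x y) ⊎
    ((∀ a b → ¬ 𝒞 a b) × Closure Rs _≺_ x y)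

  S : Rel Carrier ℓ → Rel Carrier ℓ → Rel Carrier ℓ
  S = S[ SI ∷ WO ∷ AND ∷ OR ∷ [] ]

record SpAlgebra {ℓ : Level} (A : BoundedLattice ℓ ℓ ℓ) : Set (suc ℓ) where
  open BoundedLattice A using (Carrier; _≈_; _≤_; _∧_; _∨_; ⊤; ⊥)
  open Relations A
  infix 4 _≺_
  field
    _≺_ : Rel Carrier ℓ
    𝒞   : Rel Carrier ℓ

    ⊥≺⊥   : ⊥ ≺ ⊥
    ⊤≺⊤   : ⊤ ≺ ⊤
    ≺-SI  : _≺_ Satisfies SI
    ≺-WO  : _≺_ Satisfies WO
    ≺-AND : _≺_ Satisfies AND
    ≺-OR  : _≺_ Satisfies OR

    𝒞-resp-≈ : 𝒞 Respects₂ _≈_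

  𝒞̅ : Rel Carrier ℓ
  𝒞̅ a b = ¬ 𝒞 a b

  field
    ⊥𝒞̅⊤    : 𝒞̅ ⊥ ⊤
    ⊤𝒞̅⊥    : 𝒞̅ ⊤ ⊥
    𝒞̅-downˡ : ∀ {a b c} → 𝒞̅ b c → a ≤ b → 𝒞̅ a c
    𝒞̅-downʳ : ∀ {a b c} → 𝒞̅ a c → b ≤ c → 𝒞̅ a b
    𝒞̅-∨ʳ    : ∀ {a b c} → 𝒞̅ a b → 𝒞̅ a c → 𝒞̅ a (b ∨ c)
    𝒞̅-∨ˡ    : ∀ {a b c} → 𝒞̅ a c → 𝒞̅ b c → 𝒞̅ (a ∨ b) c

  Updirected : List Condition → Set ℓ
  Updirected Rs = ∀ {a b c d} → 𝒞 a b → 𝒞 c d →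
    ∃₂ λ e f → 𝒞 e f ×
      ((Closure⁺ Rs _≺_ a b ∪ Closure⁺ Rs _≺_ c d) ⇒ Closure⁺ Rs _≺_ e f)

------------------------------------------------------------------------
-- Canonical extensions

module _ {d e f : Level} (P : Poset d e f) where
  open Poset P

  IsSupremum IsInfimum : {i : Level} {I : Set i} →
                         (I → Carrier) → Carrier → Set (i ⊔ d ⊔ f)
  IsSupremum g u = (∀ i → g i ≤ u) × (∀ v → (∀ i → g i ≤ v) → u ≤ v)
  IsInfimum  g u = (∀ i → u ≤ g i) × (∀ v → (∀ i → v ≤ g i) → v ≤ u)

  UpDirected DownDirected : {p : Level} → Pred Carrier p → Set (d ⊔ f ⊔ p)
  UpDirected   X = ∀ {a b} → a ∈ X → b ∈ X → ∃ λ c → c ∈ X × a ≤ c × b ≤ c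
  DownDirected X = ∀ {a b} → a ∈ X → b ∈ X → ∃ λ c → c ∈ X × c ≤ a × c ≤ b

-- Completeness refers to families indexed by sets of level ℓ; when d ≤ ℓ these
-- include all subsets given by predicates of level ℓ.  The finitary operations
-- are determined by the order and are included for convenience.
record CompleteLattice (ℓ d e f : Level) : Set (suc (ℓ ⊔ d ⊔ e ⊔ f)) where
  field
    boundedLattice : BoundedLattice d e f
  open BoundedLattice boundedLattice public
  field
    ⋁ ⋀   : {I : Set ℓ} → (I → Carrier) → Carrier
    ⋁-sup : {I : Set ℓ} (g : I → Carrier) → IsSupremum poset g (⋁ g)
    ⋀-inf : {I : Set ℓ} (g : I → Carrier) → IsInfimum poset g (⋀ g)

record CanonicalExtension {ℓ : Level} (A : Poset ℓ ℓ ℓ) (d e f : Level)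
                          : Set (suc (suc ℓ ⊔ d ⊔ e ⊔ f)) where
  private module A = Poset A
  field
    completeLattice : CompleteLattice ℓ d e f
  open CompleteLattice completeLattice public
  field
    ι             : A.Carrier → Carrier
    ι-isEmbedding : IsOrderMonomorphism A._≈_ _≈_ A._≤_ _≤_ ι

  ⋁ᴬ : Pred A.Carrier ℓ → Carrier
  ⋁ᴬ X = ⋁ {I = ∃ X} (ι ∘ proj₁)

  ⋀ᴬ : Pred A.Carrier ℓ → Carrier
  ⋀ᴬ X = ⋀ {I = ∃ X} (ι ∘ proj₁)

  IsClosed : Pred Carrier (suc ℓ ⊔ e)
  IsClosed k = ∃ λ (F : Pred A.Carrier ℓ) →
    Satisfiable F × DownDirected A F × k ≈ ⋀ᴬ F

  IsOpen : Pred Carrier (suc ℓ ⊔ e)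
  IsOpen o = ∃ λ (I : Pred A.Carrier ℓ) →
    Satisfiable I × UpDirected A I × o ≈ ⋁ᴬ I

  -- The indexing level in the denseness axioms is large enough for the family
  -- of all closed elements below (open elements above) a given element.
  field
    dense-closed : ∀ u → Σ (Set (suc ℓ ⊔ d ⊔ e ⊔ f)) λ I → ∃ λ (k : I → Carrier) →
                   (∀ i → IsClosed (k i)) × IsSupremum poset k u
    dense-open   : ∀ u → Σ (Set (suc ℓ ⊔ d ⊔ e ⊔ f)) λ I → ∃ λ (o : I → Carrier) →
                   (∀ i → IsOpen (o i)) × IsInfimum poset o u
    compact      : ∀ {F I : Pred A.Carrier ℓ} →
                   Satisfiable F → DownDirected A F →
                   Satisfiable I → UpDirected A I →
                   ⋀ᴬ F ≤ ⋁ᴬ I → ∃₂ λ a b → a ∈ F × b ∈ I × a A.≤ b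

  ■[_] : Rel A.Carrier ℓ → A.Carrier → Carrier
  ■[ R ] b = ⋁ᴬ (λ a → R a b)

{-# OPTIONS --safe #-}

-- Updirectedness makes {a | a S b} closed under binary joins, so
-- ■ₛ b and ■ c are joins of ideals.  For (a) ⇒ (b), denseness reduces the claim
-- to closed k = ⋀ F below ■ₛ (c ⇨ ⊥) ∧ ■ c; compactness then yields a single
-- a ∈ F with a S (c ⇨ ⊥) and a ≺ c, hence a ≤ ⊥ by cross-coherence.  Conversely,
-- b ∧ c ≤ ⊥ means b ≤ c ⇨ ⊥, so a lies below both joins in (b).
module Submission where

open import Defs
open import Data.List.Base using ([]; _∷_)
open import Data.List.Membership.Propositional using () renaming (_∈_ to _∈ˡ_)
open import Data.List.Relation.Unary.Any using (here; there)
open import Data.Product.Base using (∃; _×_; _,_; proj₁; proj₂)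
open import Data.Sum.Base using (_⊎_; inj₁; inj₂)
open import Function.Bundles using (_⇔_; mk⇔)
open import Level using (Level)
open import Relation.Binary.Bundles using (Poset)
open import Relation.Binary.Core using (Rel; _⇒_)
open import Relation.Binary.Lattice.Bundles using (BoundedLattice; HeytingAlgebra)
open import Relation.Binary.Morphism.Structures using (IsOrderMonomorphism)
open import Relation.Binary.PropositionalEquality using () renaming (refl to ≡-refl)
open import Relation.Nullary.Negation using (contradiction)
open import Relation.Unary using (Pred; _∈_; Satisfiable)

module _ {ℓ : Level} (A : BoundedLattice ℓ ℓ ℓ) where
  open BoundedLattice A using (Carrier; _≈_; module Eq)
  open Relations A

  closure-extend : ∀ {Rs Rs′ _≺_ _≺′_} → (∀ X → X ∈ˡ Rs → X ∈ˡ Rs′) →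
                   _≺_ ⇒ Closure Rs′ _≺′_ → Closure Rs _≺_ ⇒ Closure Rs′ _≺′_
  closure-extend Rs⊆Rs′ = closure-least (Closure _ _)
    ((λ y≈z → resp Eq.refl y≈z) , (λ x≈y → resp x≈y Eq.refl))
    (λ X X∈Rs → closure-satisfies X (Rs⊆Rs′ X X∈Rs))

  -- By minimality it suffices to place the generators in the larger closure, and the added pair is
  -- there by assumption. This lets derivations from two different pairs of `𝒞` be continued over
  -- one common pair.
  closure⁺-absorb : ∀ {Rs _≺_ a b e f} → Closure⁺ Rs _≺_ e f a b →
                    Closure⁺ Rs _≺_ a b ⇒ Closure⁺ Rs _≺_ e f
  closure⁺-absorb a~b = closure-extend (λ _ X∈Rs → X∈Rs) λ where
    (inj₁ x≺y)         → base (inj₁ x≺y)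
    (inj₂ (x≈a , y≈b)) → resp (Eq.sym x≈a) (Eq.sym y≈b) a~b

  S-SI : ∀ {Rs _≺_ 𝒞} → SI ∈ˡ Rs → S[ Rs ] _≺_ 𝒞 Satisfies SI
  S-SI m a≤b (inj₁ (p , q , p𝒞q , r)) = inj₁ (p , q , p𝒞q , si m a≤b r)
  S-SI m a≤b (inj₂ (𝒞-empty , r))     = inj₂ (𝒞-empty , si m a≤b r)

  S-WO : ∀ {Rs _≺_ 𝒞} → WO ∈ˡ Rs → S[ Rs ] _≺_ 𝒞 Satisfies WO
  S-WO m (inj₁ (p , q , p𝒞q , r)) x≤y = inj₁ (p , q , p𝒞q , wo m r x≤y)
  S-WO m (inj₂ (𝒞-empty , r))     x≤y = inj₂ (𝒞-empty , wo m r x≤y)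

  -- Only the pairs (p , q) and (p′ , q′) themselves need to be related in a
  -- common extension, so updirectedness for any sublist of Rs suffices.
  S-OR : ∀ {Rs Rs′} (ℍ : SpAlgebra A) → let open SpAlgebra ℍ in
         (∀ X → X ∈ˡ Rs′ → X ∈ˡ Rs) → Updirected Rs′ →
         OR ∈ˡ Rs → S[ Rs ] _≺_ 𝒞 Satisfies OR
  S-OR ℍ Rs′⊆Rs up m (inj₁ (p , q , p𝒞q , r)) (inj₁ (p′ , q′ , p′𝒞q′ , r′))
    with e , f , e𝒞f , ∪⊆ ← up p𝒞q p′𝒞q′
    = inj₁ (e , f , e𝒞f , or m
        (closure⁺-absorb (widen (∪⊆ (inj₁ pair))) r)
        (closure⁺-absorb (widen (∪⊆ (inj₂ pair))) r′))
    where
    open SpAlgebra ℍ using (_≺_)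

    pair : ∀ {Rs a b} → Closure⁺ Rs _≺_ a b a b
    pair = base (inj₂ (Eq.refl , Eq.refl))

    widen : ∀ {a b} → Closure⁺ _ _≺_ a b ⇒ Closure⁺ _ _≺_ a b
    widen = closure-extend Rs′⊆Rs base
  -- The two forms of membership in `S` exclude each other: one exhibits a pair of `𝒞`, the other
  -- asserts that there is none.
  S-OR _ _ _ _ (inj₁ (p , q , p𝒞q , _)) (inj₂ (𝒞-empty , _)) =
    contradiction p𝒞q (𝒞-empty p q)
  S-OR _ _ _ _ (inj₂ (𝒞-empty , _)) (inj₁ (p , q , p𝒞q , _)) =
    contradiction p𝒞q (𝒞-empty p q)
  S-OR _ _ _ m (inj₂ (𝒞-empty , r)) (inj₂ (_ , r′)) =
    inj₂ (𝒞-empty , or m r r′)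

module _ {ℓ d e f : Level} (A : BoundedLattice ℓ ℓ ℓ)
         (Aᵟ : CanonicalExtension (BoundedLattice.poset A) d e f) where
  private module Aᵟ = CanonicalExtension Aᵟ
  open BoundedLattice A
  open Relations A
  open Aᵟ using (ι; ⋁ᴬ; ⋀ᴬ; ■[_])
  open IsOrderMonomorphism Aᵟ.ι-isEmbedding using (mono)

  ι≤■ : ∀ (R : Rel Carrier ℓ) {a b} → R a b → ι a Aᵟ.≤ ■[ R ] b
  ι≤■ R aRb = proj₁ (Aᵟ.⋁-sup _) (_ , aRb)

  ⋀ᴬ≤ι : ∀ {F : Pred Carrier ℓ} {a} → a ∈ F → ⋀ᴬ F Aᵟ.≤ ι a
  ⋀ᴬ≤ι a∈F = proj₁ (Aᵟ.⋀-inf _) (_ , a∈F)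

  -- Since `ι` is given only as an order embedding, this comes from denseness: an open element is
  -- the join of an inhabited family from `A`, hence lies above `ι ⊥`, and `Aᵟ.⊥` is a meet of such
  -- elements.
  ι⊥≤⊥ : ι ⊥ Aᵟ.≤ Aᵟ.⊥
  ι⊥≤⊥ with _ , _ , o-open , _ , greatest ← Aᵟ.dense-open Aᵟ.⊥
    = greatest (ι ⊥) λ i →
        let _ , (a , a∈I) , _ , o≈⋁I = o-open i in
        Aᵟ.trans (mono (minimum a))
          (Aᵟ.trans (proj₁ (Aᵟ.⋁-sup _) (a , a∈I))
                    (Aᵟ.reflexive (Aᵟ.Eq.sym o≈⋁I)))

  -- The ideal is enlarged by the elements below ⊥ because it need not be
  -- constructively inhabited: ⊥ S b, for instance, requires deciding whether 𝒞
  -- is empty.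
  compact-■ : ∀ (R : Rel Carrier ℓ) {F : Pred Carrier ℓ} {b} →
              R Satisfies SI → R Satisfies OR →
              Satisfiable F → DownDirected poset F →
              ⋀ᴬ F Aᵟ.≤ ■[ R ] b → ∃ λ a → a ∈ F × (R a b ⊎ a ≤ ⊥)
  compact-■ R {F} {b} R-SI R-OR F-inh F-dir ⋀F≤■b = result
    where
    I : Pred Carrier ℓ
    I a = R a b ⊎ a ≤ ⊥

    I-dir : UpDirected poset I
    I-dir {x} {y} (inj₁ xRb) (inj₁ yRb) =
      x ∨ y , inj₁ (R-OR xRb yRb) , x≤x∨y x y , y≤x∨y x y
    I-dir {x} {y} x∈I (inj₂ y≤⊥) = x , x∈I , refl , trans y≤⊥ (minimum x)
    I-dir {x} {y} (inj₂ x≤⊥) y∈I = y , y∈I , trans x≤⊥ (minimum y) , refl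

    ■b≤⋁I : ■[ R ] b Aᵟ.≤ ⋁ᴬ I
    ■b≤⋁I = proj₂ (Aᵟ.⋁-sup _) _ λ (a , aRb) →
      proj₁ (Aᵟ.⋁-sup _) (a , inj₁ aRb)

    result : ∃ λ a → a ∈ F × (R a b ⊎ a ≤ ⊥)
    result
      with Aᵟ.compact F-inh F-dir (⊥ , inj₂ (minimum ⊥)) I-dir
             (Aᵟ.trans ⋀F≤■b ■b≤⋁I)
    -- The bound `x` supplied by compactness need not lie in `F`; `R-SI` carries the relation down
    -- to `a`.
    ... | a , _ , a∈F , inj₁ xRb , a≤x = a , a∈F , inj₁ (R-SI a≤x xRb)
    ... | a , _ , a∈F , inj₂ x≤⊥ , a≤x = a , a∈F , inj₂ (trans a≤x x≤⊥)

  ■∧■≤⊥ : ∀ (R Q : Rel Carrier ℓ) {b c} →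
          R Satisfies SI → R Satisfies OR → Q Satisfies SI → Q Satisfies OR →
          (∀ a → R a b → Q a c → a ≤ ⊥) →
          (■[ R ] b Aᵟ.∧ ■[ Q ] c) Aᵟ.≤ Aᵟ.⊥
  ■∧■≤⊥ R Q {b} {c} R-SI R-OR Q-SI Q-OR disjoint
    with _ , _ , k-closed , k≤u , least ← Aᵟ.dense-closed (■[ R ] b Aᵟ.∧ ■[ Q ] c)
    = least Aᵟ.⊥ λ i →
        let F , F-inh , F-dir , k≈⋀F = k-closed i
            ⋀F≤u = Aᵟ.trans (Aᵟ.reflexive (Aᵟ.Eq.sym k≈⋀F)) (k≤u i)
            x , x∈F , xRb = compact-■ R R-SI R-OR F-inh F-dir
                              (Aᵟ.trans ⋀F≤u (Aᵟ.x∧y≤x _ _))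
            y , y∈F , yQc = compact-■ Q Q-SI Q-OR F-inh F-dir
                              (Aᵟ.trans ⋀F≤u (Aᵟ.x∧y≤y _ _))
            -- Compactness was applied once for each join, with possibly different results `x` and
            -- `y`. A common lower bound in `F` inherits both relations by `R-SI` and `Q-SI`.
            z , z∈F , z≤x , z≤y = F-dir x∈F y∈F
        in
        Aᵟ.trans (Aᵟ.reflexive k≈⋀F)
          (Aᵟ.trans (⋀ᴬ≤ι z∈F)
            (Aᵟ.trans (mono (below z≤x z≤y xRb yQc)) ι⊥≤⊥))
    where
    below : ∀ {x y z} → z ≤ x → z ≤ y → R x b ⊎ x ≤ ⊥ → Q y c ⊎ y ≤ ⊥ → z ≤ ⊥
    below z≤x z≤y (inj₁ xRb) (inj₁ yQc) = disjoint _ (R-SI z≤x xRb) (Q-SI z≤y yQc)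
    below z≤x z≤y (inj₂ x≤⊥) _          = trans z≤x x≤⊥
    below z≤x z≤y _          (inj₂ y≤⊥) = trans z≤y y≤⊥

mainTheorem9 :
  {l ℓ d e f : Level}
  (𝓛 : SelfextensionalLogic l)
  (A : HeytingAlgebra ℓ ℓ ℓ) →
  let open HeytingAlgebra A
      open SelfextensionalLogic 𝓛 using (signature) in
  (𝐀 : AlgebraOn signature (Poset.Eq.setoid poset)) →
  let open Filters 𝓛 poset 𝐀 in
  InAlg →
  (ℍ : SpAlgebra boundedLattice) →
  let open SpAlgebra ℍ
      _S_ = Relations.S boundedLattice _≺_ 𝒞 in
  𝒞 ⇒ 𝒞[ _≺_ ] →
  (∀ (X : Condition) → Updirected (X ∷ [])) →
  (Aᵟ : CanonicalExtension poset d e f) →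
  let module Aᵟ = CanonicalExtension Aᵟ
      open Aᵟ using (■[_]) in
  (∀ (a b c : Carrier) → a S b → a ≺ c → b ∧ c ≤ ⊥ → a ≤ ⊥)
    ⇔
  (∀ (c : Carrier) → (■[ _S_ ] (c ⇨ ⊥) Aᵟ.∧ ■[ _≺_ ] c) Aᵟ.≤ Aᵟ.⊥)
mainTheorem9 {ℓ = ℓ} _ A _ _ ℍ _ up Aᵟ = mk⇔ a⇒b b⇒a
  where
  open HeytingAlgebra A
  open SpAlgebra ℍ
  module Aᵟ = CanonicalExtension Aᵟ
  open Aᵟ using (■[_])
  open IsOrderMonomorphism Aᵟ.ι-isEmbedding using (cancel)

  _S_ : Rel Carrier ℓ
  _S_ = Relations.S boundedLattice _≺_ 𝒞

  a⇒b : (∀ a b c → a S b → a ≺ c → b ∧ c ≤ ⊥ → a ≤ ⊥) →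
        ∀ c → (■[ _S_ ] (c ⇨ ⊥) Aᵟ.∧ ■[ _≺_ ] c) Aᵟ.≤ Aᵟ.⊥
  a⇒b coherent c = ■∧■≤⊥ boundedLattice Aᵟ _S_ _≺_
    (S-SI boundedLattice (here ≡-refl))
    (S-OR boundedLattice ℍ (λ { _ (here eq) → here eq }) (up SI)
      (there (there (there (here ≡-refl)))))
    ≺-SI ≺-OR
    -- Cross-coherence is used at the pseudocomplement of `c`; the last argument is
    -- `(c ⇨ ⊥) ∧ c ≤ ⊥`.
    λ a aS¬c a≺c → coherent a (c ⇨ ⊥) c aS¬c a≺c (transpose-∧ refl)

  b⇒a : (∀ c → (■[ _S_ ] (c ⇨ ⊥) Aᵟ.∧ ■[ _≺_ ] c) Aᵟ.≤ Aᵟ.⊥) →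
        ∀ a b c → a S b → a ≺ c → b ∧ c ≤ ⊥ → a ≤ ⊥
  -- The inequality is proved as `ι a Aᵟ.≤ ι ⊥` and reflected back to `A`; passing from `Aᵟ.⊥` to
  -- `ι ⊥` is the trivial direction.
  b⇒a ■∧■≤ a b c aSb a≺c b∧c≤⊥ = cancel
    (Aᵟ.trans
      (Aᵟ.∧-greatest
        (ι≤■ boundedLattice Aᵟ _S_
          (S-WO boundedLattice (there (here ≡-refl)) aSb (transpose-⇨ b∧c≤⊥)))
        (ι≤■ boundedLattice Aᵟ _≺_ a≺c))
      (Aᵟ.trans (■∧■≤ c) (Aᵟ.minimum _)))
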